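{- There exists $n_0$ such that for every $n\ge n_0$, every $n$-vertex graph $G$ with minimum degree at least $2n/3$ has a signing $\sigma$ such that $W_\sigma(G)=W_\sigma(G-v)=0$ for all $v\in V(G)$.
   Context: Graphs are finite and simple. A signing of $G$ is a function $\sigma:E(G)\to\{\pm1\}$. For a path $P$, $\sigma(P)=\sum_{e\in P}\sigma(e)$. The signed distance in a graph $H$ is $d_\sigma(u,v)=\min_P|\sigma(P)|$ over all $uv$-paths $P$ in $H$ ($\infty$ if none exists, $0$ if $u=v$), and $W_\sigma(H)=\frac12\sum_{u,v\in V(H)}d_\sigma(u,v)$. For $G-v$, the signing is restricted to the edges of $G-v$ and distances are computed in $G-v$. -}

module Defs where

open import Data.Nat using (ℕ; zero; suc; _+_; _*_; _≤_; _/_; pred)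
import Data.Nat.ListAction
open import Data.Fin using (Fin; punchIn)
open import Data.List using (List; []; _∷_; map; allFin)
open import Data.List.Relation.Unary.Unique.Propositional using (Unique)
open import Data.Bool using (Bool; true; false; if_then_else_)
open import Data.Maybe using (Maybe; just; nothing)
import Data.Maybe as Maybe
open import Data.Integer using (ℤ; ∣_∣; +_; -[1+_])
import Data.Integer as ℤ
open import Data.Sign using (Sign)
open import Data.Product using (Σ; ∃; _×_; _,_)
open import Relation.Nullary using (¬_)
open import Relation.Binary.PropositionalEquality using (_≡_)

-- A finite simple graph on vertex set Fin n (adjacency symmetric, irreflexive).
record Graph (n : ℕ) : Set where
  field
    adj    : Fin n → Fin n → Bool
    sym    : ∀ u v → adj u v ≡ adj v u
    irrefl : ∀ u → adj u u ≡ false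
open Graph public

-- degree of a vertex
deg : ∀ {n} → Graph n → Fin n → ℕ
deg {n} G v = Data.Nat.ListAction.sum (map (λ u → if adj G v u then 1 else 0) (allFin n))

-- G - v : vertices of G other than v, relabelled via punchIn v.
deleteVertex : ∀ {n} → Graph n → Fin n → Graph (pred n)
deleteVertex {suc m} G v = record
  { adj    = λ i j → adj G (punchIn v i) (punchIn v j)
  ; sym    = λ i j → sym G (punchIn v i) (punchIn v j)
  ; irrefl = λ i → irrefl G (punchIn v i) }

-- A signing assigns ±1 to each (unordered) pair; only values on edges matter.
record Signing (n : ℕ) : Set where
  field
    sgn    : Fin n → Fin n → Sign
    sgnSym : ∀ u v → sgn u v ≡ sgn v u
open Signing public

signVal : Sign → ℤ
signVal Sign.+ = + 1
signVal Sign.- = -[1+ 0 ]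

-- restriction of a signing of G to G - v
restrict : ∀ {n} → Signing n → Fin n → Signing (pred n)
restrict {suc m} σ v = record
  { sgn    = λ i j → sgn σ (punchIn v i) (punchIn v j)
  ; sgnSym = λ i j → sgnSym σ (punchIn v i) (punchIn v j) }

-- walks in G from u to w
data Walk {n : ℕ} (G : Graph n) : Fin n → Fin n → Set where
  here : ∀ u → Walk G u u
  step : ∀ {u v w} → adj G u v ≡ true → Walk G v w → Walk G u w

vertices : ∀ {n} {G : Graph n} {u w} → Walk G u w → List (Fin n)
vertices (here u) = u ∷ []
vertices (step {u = u} _ P) = u ∷ vertices P

-- a path is a walk with no repeated vertex
Path : ∀ {n} → Graph n → Fin n → Fin n → Set
Path G u w = Σ (Walk G u w) (λ P → Unique (vertices P))

-- σ(P) = sum of the signs of the edges of P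
weight : ∀ {n} {G : Graph n} → Signing n → ∀ {u w} → Walk G u w → ℤ
weight σ (here u) = + 0
weight σ (step {u = u} {v = v} _ P) = signVal (sgn σ u v) ℤ.+ weight σ P

-- IsSignedDist G σ u w d : d is the signed distance d_σ(u,w) in G
-- (nothing = ∞ when no uw-path exists; otherwise the minimum of |σ(P)|).
IsSignedDist : ∀ {n} → Graph n → Signing n → Fin n → Fin n → Maybe ℕ → Set
IsSignedDist G σ u w nothing  = ¬ Path G u w
IsSignedDist G σ u w (just k) =
  (Σ (Path G u w) λ P → ∣ weight σ (Data.Product.proj₁ P) ∣ ≡ k)
  × (∀ (P : Path G u w) → k ≤ ∣ weight σ (Data.Product.proj₁ P) ∣)

-- addition on ℕ ∪ {∞}
_⊕_ : Maybe ℕ → Maybe ℕ → Maybe ℕ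
just a ⊕ just b = just (a + b)
_ ⊕ _ = nothing

sumM : List (Maybe ℕ) → Maybe ℕ
sumM [] = just 0
sumM (x ∷ xs) = x ⊕ sumM xs

-- W = (1/2) Σ_{u,v} d(u,v)
wiener : ∀ {n} → (Fin n → Fin n → Maybe ℕ) → Maybe ℕ
wiener {n} d = Maybe.map (λ s → s / 2) (sumM (map (λ u → sumM (map (λ v → d u v) (allFin n))) (allFin n)))

-- W_σ(G) = w : the signed-distance function of (G,σ) has Wiener index w
SignedWiener : ∀ {n} → Graph n → Signing n → Maybe ℕ → Set
SignedWiener {n} G σ w =
  Σ (Fin n → Fin n → Maybe ℕ) λ d → (∀ u v → IsSignedDist G σ u v (d u v)) × wiener d ≡ w

-- Sign each edge uv by ε(u)ε(v) for a labelling ε : V → {±1} that takes each value at least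
-- twice.  Along a path u–x–w with ε(u) ≠ ε(w) the two edges then have opposite signs, and when
-- ε(u) = ε(w) the path u–x–y–z–w through any y with ε(y) ≠ ε(u) splits into two such pieces;
-- so every pair of vertices is joined by a path of signed length 0.  Minimum degree 2n/3 gives
-- any two vertices n/3 common neighbours, which for n ≥ 10 leaves room to choose x and z
-- distinct from the other path vertices, in G and in every G − v.
module Submission where

open import Defs hiding (sym)
import Algebra.Properties.CommutativeMonoid.Sum as ∑
open import Data.Bool using (Bool; true; false; _∧_; if_then_else_)
import Data.Bool.Properties as Bool
open import Data.Empty using (⊥-elim)
open import Data.Fin using (Fin; zero; suc; punchIn; punchOut)
open import Data.Fin.Properties using (_≟_; any?; all?; punchIn-punchOut)
open import Data.Integer using (0ℤ; ∣_∣)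
import Data.Integer as ℤ
import Data.Integer.Properties as ℤ
open import Data.List using (List; []; _∷_; map; allFin; tabulate)
open import Data.List.Properties using (map-tabulate)
open import Data.List.Relation.Unary.All using ([]; _∷_)
open import Data.List.Relation.Unary.AllPairs using ([]; _∷_)
open import Data.Maybe using (just)
import Data.Maybe as Maybe
open import Data.Nat using (ℕ; zero; suc; _+_; _*_; _/_; _≤_; _<_; z≤n; s≤s)
import Data.Nat.ListAction as ListAction
open import Data.Nat.Properties hiding (_≟_)
open import Data.Nat.Tactic.RingSolver using (solve-∀)
open import Data.Product using (∃; ∃₂; Σ; _×_; _,_; proj₁)
open import Data.Sign as Sign using (Sign; opposite)
import Data.Sign.Properties as Sign
open import Function using (id; _∘_)
open import Relation.Nullary using (yes; no; does)
open import Relation.Nullary.Decidable using (¬?; _×-dec_; dec-true)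
open import Relation.Binary.PropositionalEquality
  using (_≡_; _≢_; refl; sym; trans; cong; cong₂; ≢-sym; module ≡-Reasoning)

open ∑ +-0-commutativeMonoid
  using (sum; sum-syntax; sum-remove; sum-cong-≗; sum-replicate-zero; ∑-comm; ∑-distrib-+)

𝟙 : Bool → ℕ
𝟙 b = if b then 1 else 0

𝟙≤1 : ∀ b → 𝟙 b ≤ 1
𝟙≤1 true  = ≤-refl
𝟙≤1 false = z≤n

sum-map-allFin : ∀ {n} (f : Fin n → ℕ) → ListAction.sum (map f (allFin n)) ≡ sum f
sum-map-allFin {n} f = trans (cong ListAction.sum (map-tabulate id f)) (sum-tabulate f)
  where
  sum-tabulate : ∀ {m} (g : Fin m → ℕ) → ListAction.sum (tabulate g) ≡ sum g
  sum-tabulate {zero}  g = refl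
  sum-tabulate {suc m} g = cong (g zero +_) (sum-tabulate (g ∘ suc))

∑-mono-≤ : ∀ {n} {f g : Fin n → ℕ} → (∀ i → f i ≤ g i) → sum f ≤ sum g
∑-mono-≤ {zero}  f≤g = z≤n
∑-mono-≤ {suc n} f≤g = +-mono-≤ (f≤g zero) (∑-mono-≤ (f≤g ∘ suc))

∑-one : ∀ n → ∑[ i < n ] 1 ≡ n
∑-one zero    = refl
∑-one (suc n) = cong suc (∑-one n)

f≤∑f : ∀ {n} (f : Fin n → ℕ) i → f i ≤ sum f
f≤∑f {suc n} f i = ≤-trans (m≤m+n (f i) _) (≤-reflexive (sym (sum-remove {i = i} f)))

∑-𝟙-≟ : ∀ {n} (e : Fin n) → ∑[ x < n ] 𝟙 (does (x ≟ e)) ≡ 1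
∑-𝟙-≟ {suc n} zero    = cong suc (sum-replicate-zero n)
∑-𝟙-≟ {suc n} (suc e) = ∑-𝟙-≟ e

∃-avoiding : ∀ {n k} (p : Fin n → Bool) (es : Fin k → Fin n) → k < ∑[ x < n ] 𝟙 (p x) →
            ∃ λ x → p x ≡ true × (∀ j → x ≢ es j)
∃-avoiding {n} {k} p es k<∑ with any? (λ x → (p x Bool.≟ true) ×-dec all? (λ j → ¬? (x ≟ es j)))
... | yes found = found
... | no none   = ⊥-elim (<⇒≱ k<∑ (begin
  ∑[ x < n ] 𝟙 (p x)                           ≤⟨ ∑-mono-≤ covered ⟩
  ∑[ x < n ] ∑[ j < k ] 𝟙 (does (x ≟ es j))   ≡⟨ ∑-comm {n} {k} _ ⟩
  ∑[ j < k ] ∑[ x < n ] 𝟙 (does (x ≟ es j))   ≡⟨ sum-cong-≗ (∑-𝟙-≟ ∘ es) ⟩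
  ∑[ j < k ] 1                                 ≡⟨ ∑-one k ⟩
  k                                            ∎))
  where
  open ≤-Reasoning
  covered : ∀ x → 𝟙 (p x) ≤ ∑[ j < k ] 𝟙 (does (x ≟ es j))
  covered x with p x in px | any? (λ j → x ≟ es j)
  ... | false | _              = z≤n
  ... | true  | yes (j , x≡eⱼ) = ≤-trans (≤-reflexive (cong 𝟙 (sym (dec-true (x ≟ es j) x≡eⱼ)))) (f≤∑f _ j)
  ... | true  | no x∉es        = ⊥-elim (none (x , px , λ j x≡eⱼ → x∉es (j , x≡eⱼ)))

deg≡∑ : ∀ {n} (G : Graph n) v → deg G v ≡ ∑[ u < n ] 𝟙 (adj G v u)
deg≡∑ {n} G v = sum-map-allFin {n} _

codegree : ∀ {n} → Graph n → Fin n → Fin n → ℕ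
codegree {n} G a b = ∑[ x < n ] 𝟙 (adj G a x ∧ adj G b x)

deg+deg≤n+codegree : ∀ {n} (G : Graph n) a b → deg G a + deg G b ≤ n + codegree G a b
deg+deg≤n+codegree {n} G a b = begin
  deg G a + deg G b                                       ≡⟨ cong₂ _+_ (deg≡∑ G a) (deg≡∑ G b) ⟩
  ∑[ x < n ] 𝟙 (adj G a x) + ∑[ x < n ] 𝟙 (adj G b x)     ≡⟨ sym (∑-distrib-+ {n} _ _) ⟩
  ∑[ x < n ] (𝟙 (adj G a x) + 𝟙 (adj G b x))              ≤⟨ ∑-mono-≤ (λ x → 𝟙+𝟙≤1+𝟙∧ (adj G a x) (adj G b x)) ⟩
  ∑[ x < n ] (1 + 𝟙 (adj G a x ∧ adj G b x))              ≡⟨ ∑-distrib-+ {n} _ _ ⟩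
  ∑[ x < n ] 1 + codegree G a b                           ≡⟨ cong (_+ codegree G a b) (∑-one n) ⟩
  n + codegree G a b                                      ∎
  where
  open ≤-Reasoning
  𝟙+𝟙≤1+𝟙∧ : ∀ a b → 𝟙 a + 𝟙 b ≤ 1 + 𝟙 (a ∧ b)
  𝟙+𝟙≤1+𝟙∧ true  true  = ≤-refl
  𝟙+𝟙≤1+𝟙∧ true  false = ≤-refl
  𝟙+𝟙≤1+𝟙∧ false b     = 𝟙≤1 b

minDegree⇒n≤3*codegree : ∀ {n} (G : Graph n) → (∀ v → 2 * n ≤ 3 * deg G v) →
                         ∀ a b → n ≤ 3 * codegree G a b
minDegree⇒n≤3*codegree {n} G minDeg a b = +-cancelˡ-≤ (3 * n) n (3 * c) (begin
  3 * n + n                    ≡⟨ 4n≡2n+2n n ⟩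
  2 * n + 2 * n                ≤⟨ +-mono-≤ (minDeg a) (minDeg b) ⟩
  3 * deg G a + 3 * deg G b    ≡⟨ sym (*-distribˡ-+ 3 (deg G a) (deg G b)) ⟩
  3 * (deg G a + deg G b)      ≤⟨ *-monoʳ-≤ 3 (deg+deg≤n+codegree G a b) ⟩
  3 * (n + c)                  ≡⟨ *-distribˡ-+ 3 n c ⟩
  3 * n + 3 * c                ∎)
  where
  open ≤-Reasoning
  c = codegree G a b
  4n≡2n+2n : ∀ n → 3 * n + n ≡ 2 * n + 2 * n
  4n≡2n+2n = solve-∀

codegree≤1+codegree-deleteVertex : ∀ {m} (G : Graph (suc m)) v a b →
  codegree G (punchIn v a) (punchIn v b) ≤ suc (codegree (deleteVertex G v) a b)
codegree≤1+codegree-deleteVertex G v a b =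
  ≤-trans (≤-reflexive (sum-remove {i = v} (λ x → 𝟙 (adj G (punchIn v a) x ∧ adj G (punchIn v b) x))))
          (+-monoˡ-≤ _ (𝟙≤1 _))

switching : ∀ {n} → (Fin n → Sign) → Signing n
switching ε = record { sgn = λ u v → ε u Sign.* ε v ; sgnSym = λ u v → Sign.*-comm (ε u) (ε v) }

signVal-cancel : ∀ s k → signVal s ℤ.+ (signVal (opposite s) ℤ.+ k) ≡ k
signVal-cancel s k = begin
  signVal s ℤ.+ (signVal (opposite s) ℤ.+ k)  ≡⟨ ℤ.+-assoc (signVal s) _ k ⟨
  (signVal s ℤ.+ signVal (opposite s)) ℤ.+ k  ≡⟨ cong (ℤ._+ k) (opposite-cancels s) ⟩
  0ℤ ℤ.+ k                                    ≡⟨ ℤ.+-identityˡ k ⟩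
  k                                           ∎
  where
  open ≡-Reasoning
  opposite-cancels : ∀ s → signVal s ℤ.+ signVal (opposite s) ≡ 0ℤ
  opposite-cancels Sign.+ = refl
  opposite-cancels Sign.- = refl

≢⇒*-opposite : ∀ {s r} → s ≢ r → ∀ t → t Sign.* r ≡ opposite (s Sign.* t)
≢⇒*-opposite {Sign.+} {Sign.+} s≢r t      = ⊥-elim (s≢r refl)
≢⇒*-opposite {Sign.-} {Sign.-} s≢r t      = ⊥-elim (s≢r refl)
≢⇒*-opposite {Sign.+} {Sign.-} s≢r Sign.+ = refl
≢⇒*-opposite {Sign.+} {Sign.-} s≢r Sign.- = refl
≢⇒*-opposite {Sign.-} {Sign.+} s≢r Sign.+ = refl
≢⇒*-opposite {Sign.-} {Sign.+} s≢r Sign.- = refl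

-- Under a switching signing, two consecutive edges s—t—r with s ≢ r have opposite signs.
signVal-twoSteps : ∀ {s r} → s ≢ r → ∀ t k →
                   signVal (s Sign.* t) ℤ.+ (signVal (t Sign.* r) ℤ.+ k) ≡ k
signVal-twoSteps {s} s≢r t k =
  trans (cong (λ u → signVal (s Sign.* t) ℤ.+ (signVal u ℤ.+ k)) (≢⇒*-opposite s≢r t))
        (signVal-cancel (s Sign.* t) k)

ZeroWeightPath : ∀ {n} → Graph n → Signing n → Fin n → Fin n → Set
ZeroWeightPath H σ u w = Σ (Path H u w) λ P → ∣ weight σ (proj₁ P) ∣ ≡ 0

zeroWeightPaths⇒signedWiener≡0 : ∀ {n} (H : Graph n) (σ : Signing n) →
  (∀ u w → ZeroWeightPath H σ u w) → SignedWiener H σ (just 0)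
zeroWeightPaths⇒signedWiener≡0 {n} H σ paths =
  (λ _ _ → just 0) , (λ u w → paths u w , λ _ → z≤n) , wiener-zero
  where
  sumM-zeros : ∀ {A : Set} (xs : List A) → sumM (map (λ _ → just 0) xs) ≡ just 0
  sumM-zeros []       = refl
  sumM-zeros (_ ∷ xs) = cong (just 0 ⊕_) (sumM-zeros xs)
  wiener-zero : wiener {n} (λ _ _ → just 0) ≡ just 0
  wiener-zero = cong (Maybe.map (_/ 2))
    (trans (cong (λ s → sumM (map (λ _ → s) (allFin n))) (sumM-zeros (allFin n)))
           (sumM-zeros (allFin n)))

module _ {n} (H : Graph n) where

  adj⇒≢ : ∀ {a b} → adj H a b ≡ true → a ≢ b
  adj⇒≢ {a} ab refl with () ← trans (sym ab) (irrefl H a)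

  adj-sym : ∀ {a b} → adj H a b ≡ true → adj H b a ≡ true
  adj-sym {a} {b} ab = trans (Graph.sym H b a) ab

  commonNeighbour : ∀ {a b} → 2 < codegree H a b → ∀ e₁ e₂ →
    ∃ λ x → adj H a x ≡ true × adj H b x ≡ true × x ≢ e₁ × x ≢ e₂
  commonNeighbour {a} {b} 2<codeg e₁ e₂
    with x , abx , x∉ ← ∃-avoiding _ (λ { zero → e₁ ; (suc _) → e₂ }) 2<codeg
    = x , Bool.∧-conicalˡ _ _ abx , Bool.∧-conicalʳ _ _ abx , x∉ zero , x∉ (suc zero)

  zeroWeightPath : (ε : Fin n → Sign) → (∀ a b → 2 < codegree H a b) → (∀ s → ∃ λ y → ε y ≡ s) →
                   ∀ u w → ZeroWeightPath H (switching ε) u w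
  zeroWeightPath ε rich onto u w with u ≟ w | ε u Sign.≟ ε w
  ... | yes refl | _          = (here u , [] ∷ []) , refl
  ... | no u≢w   | no εu≢εw
    with x , ux , wx , _ ← commonNeighbour (rich u w) u w
    = (step ux (step (adj-sym wx) (here w)) ,
        (adj⇒≢ ux ∷ u≢w ∷ []) ∷ (≢-sym (adj⇒≢ wx) ∷ []) ∷ [] ∷ [])
      , cong ∣_∣ (signVal-twoSteps εu≢εw (ε x) 0ℤ)
  ... | no u≢w   | yes εu≡εw
    with y , εy≡-εu ← onto (opposite (ε u))
    with x , ux , yx , x≢w , _   ← commonNeighbour (rich u y) w w
    with z , yz , wz , z≢u , z≢x ← commonNeighbour (rich y w) u x
    = let εu≢εy : ε u ≢ ε y
          εu≢εy εu≡εy = Sign.s≢opposite[s] (ε u) (trans εu≡εy εy≡-εu)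
          εy≢εw : ε y ≢ ε w
          εy≢εw εy≡εw = εu≢εy (trans εu≡εw (sym εy≡εw))
      in (step ux (step (adj-sym yx) (step yz (step (adj-sym wz) (here w)))) ,
           (adj⇒≢ ux ∷ εu≢εy ∘ cong ε ∷ ≢-sym z≢u ∷ u≢w ∷ [])
           ∷ (≢-sym (adj⇒≢ yx) ∷ ≢-sym z≢x ∷ x≢w ∷ [])
           ∷ (adj⇒≢ yz ∷ εy≢εw ∘ cong ε ∷ [])
           ∷ (≢-sym (adj⇒≢ wz) ∷ [])
           ∷ [] ∷ [])
         , cong ∣_∣ (trans (signVal-twoSteps εu≢εy (ε x) _) (signVal-twoSteps εy≢εw (ε z) 0ℤ))

  switching-signedWiener≡0 : (ε : Fin n → Sign) → (∀ a b → 2 < codegree H a b) →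
    (∀ s → ∃ λ y → ε y ≡ s) → SignedWiener H (switching ε) (just 0)
  switching-signedWiener≡0 ε rich onto =
    zeroWeightPaths⇒signedWiener≡0 H (switching ε) (zeroWeightPath ε rich onto)

firstTwoPositive : ∀ {n} → Fin n → Sign
firstTwoPositive zero             = Sign.+
firstTwoPositive (suc zero)       = Sign.+
firstTwoPositive (suc (suc _))    = Sign.-

firstTwoPositive-twice : ∀ {n} → 4 ≤ n → ∀ s →
  ∃₂ λ p q → p ≢ q × firstTwoPositive {n} p ≡ s × firstTwoPositive q ≡ s
firstTwoPositive-twice (s≤s (s≤s (s≤s (s≤s _)))) Sign.+ = zero , suc zero , (λ ()) , refl , refl
firstTwoPositive-twice (s≤s (s≤s (s≤s (s≤s _)))) Sign.- =
  suc (suc zero) , suc (suc (suc zero)) , (λ ()) , refl , refl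

attained-punchIn : ∀ {m} {A : Set} (f : Fin (suc m) → A) (v : Fin (suc m)) {p q a} →
  p ≢ q → f p ≡ a → f q ≡ a → ∃ λ y → f (punchIn v y) ≡ a
attained-punchIn f v {p} {q} p≢q fp fq with p ≟ v
... | no p≢v   = punchOut (≢-sym p≢v) , trans (cong f (punchIn-punchOut (≢-sym p≢v))) fp
... | yes refl = punchOut p≢q , trans (cong f (punchIn-punchOut p≢q)) fq

firstTwoPositive-onto : ∀ {n} → 4 ≤ n → ∀ s → ∃ λ y → firstTwoPositive {n} y ≡ s
firstTwoPositive-onto 4≤n s with p , _ , _ , fp , _ ← firstTwoPositive-twice 4≤n s = p , fp

firstTwoPositive-punchIn-onto : ∀ {m} → 4 ≤ suc m → ∀ v s →
  ∃ λ y → firstTwoPositive (punchIn {m} v y) ≡ s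
firstTwoPositive-punchIn-onto 4≤n v s with _ , _ , p≢q , fp , fq ← firstTwoPositive-twice 4≤n s =
  attained-punchIn firstTwoPositive v p≢q fp fq

minDegree⇒3<codegree : ∀ {n} → 10 ≤ n → (G : Graph n) → (∀ v → 2 * n ≤ 3 * deg G v) →
                       ∀ a b → 3 < codegree G a b
minDegree⇒3<codegree 10≤n G minDeg a b =
  *-cancelˡ-< 3 3 _ (≤-trans 10≤n (minDegree⇒n≤3*codegree G minDeg a b))

deleteVertex-2<codegree : ∀ {m} (G : Graph (suc m)) → (∀ a b → 3 < codegree G a b) →
                          ∀ v a b → 2 < codegree (deleteVertex G v) a b
deleteVertex-2<codegree G 3<codegree v a b =
  ≤-pred (≤-trans (3<codegree (punchIn v a) (punchIn v b)) (codegree≤1+codegree-deleteVertex G v a b))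

corollary1p4 : ∃ λ (n₀ : ℕ) → ∀ (n : ℕ) → n₀ ≤ n → (G : Graph n)
    → (∀ (v : Fin n) → 2 * n ≤ 3 * deg G v)
    → ∃ λ (σ : Signing n) → SignedWiener G σ (just 0)
        × (∀ (v : Fin n) → SignedWiener (deleteVertex G v) (restrict σ v) (just 0))
-- restrict (switching ε) v is definitionally switching (ε ∘ punchIn v).
corollary1p4 = 10 , λ where
  (suc m) 10≤n G minDeg →
    let 3<codegree = minDegree⇒3<codegree 10≤n G minDeg
        4≤n        = ≤-trans (m≤m+n 4 6) 10≤n
    in switching firstTwoPositive
     , switching-signedWiener≡0 G firstTwoPositive
         (λ a b → <⇒≤ (3<codegree a b)) (firstTwoPositive-onto 4≤n)
     , λ v → switching-signedWiener≡0 (deleteVertex G v) (firstTwoPositive ∘ punchIn v)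
               (deleteVertex-2<codegree G 3<codegree v) (firstTwoPositive-punchIn-onto 4≤n v)
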